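{- Whether a tree $T$ is add-prime can be decided in time polynomial in $n_T$. That is, there is an algorithm which, given a tree $T$ with $n_T>1$, decides whether $T$ is add-prime in time bounded by a polynomial in $n_T$.
   Context: A "tree" is a finite non-empty rooted unordered tree; two trees are regarded as equal if they are isomorphic as rooted trees. $\mathbf{1}$ is the tree with exactly one vertex, $n_T$ is the number of vertices of $T$, and $r(T)$ is its root. The subtrees of $r(T)$ are the trees rooted at the children of $r(T)$, each consisting of a child and all its descendants. Addition: $A+B$ is the tree obtained by merging the roots $r(A)$ and $r(B)$ into a single new root, so that the subtrees of $r(A)$ together with the subtrees of $r(B)$ (counted with multiplicity) become the subtrees of the new root. A tree $T$ with $n_T>1$ is add-prime if it can be generated by addition only if the terms are $\mathbf{1}$ and $T$, i.e. $T=A+B$ implies that one of $A,B$ is $\mathbf{1}$ and the other is $T$. Input trees are given by any standard explicit encoding of size polynomial in $n_T$, e.g. the binary sequence of length $2n_T$ obtained by a preorder traversal writing $1$ for each vertex encountered and $0$ for each move backwards. -}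

module Defs where

open import Data.Bool using (Bool; true; false)
open import Data.Fin using (Fin)
open import Data.List using (List; []; _∷_; _++_; foldr; length; lookup; map)
open import Data.Nat using (ℕ; zero; suc; _+_; _*_; _<_)
open import Data.Product using (_×_; _,_; ∃-syntax; proj₁; proj₂)
open import Data.Sum using (_⊎_)
open import Data.Vec as Vec using (Vec)
open import Function.Bundles using (_↔_; _⇔_; module Inverse)
open import Relation.Binary.PropositionalEquality using (_≡_)
open import Relation.Nullary.Reflects using (Reflects)

-- A value of Tree is an unordered tree presented with some ordering of the
-- subtrees of each vertex.  The ordering is forgotten by _≅_ below, which is
-- the equality of unordered trees.

data Tree : Set where
  node : List Tree → Tree

subtrees : Tree → List Tree
subtrees (node ts) = ts

𝟏 : Tree
𝟏 = node []

mutual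
  size : Tree → ℕ
  size (node ts) = suc (sizes ts)

  sizes : List Tree → ℕ
  sizes []       = 0
  sizes (t ∷ ts) = size t + sizes ts

data Vertex (T : Tree) : Set where
  root  : Vertex T
  below : (i : Fin (length (subtrees T))) →
          Vertex (lookup (subtrees T) i) → Vertex T

-- u ⟶ v : u is the parent of v.
data _⟶_ {T : Tree} : Vertex T → Vertex T → Set where
  top  : ∀ i → root ⟶ below i root
  down : ∀ i {u v} → u ⟶ v → below i u ⟶ below i v

infix 4 _⟶_ _≅_

record _≅_ (T U : Tree) : Set where
  field
    bijection : Vertex T ↔ Vertex U
  open Inverse bijection public using (to; from)
  field
    root-preserved : to root ≡ root
    edge-preserved : ∀ u v → u ⟶ v ⇔ to u ⟶ to v

infixl 6 _⊕_

_⊕_ : Tree → Tree → Tree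
node as ⊕ node bs = node (as ++ bs)

AddPrime : Tree → Set
AddPrime T = 1 < size T ×
  (∀ A B → T ≅ A ⊕ B → (A ≅ 𝟏 × B ≅ T) ⊎ (A ≅ T × B ≅ 𝟏))

-- Preorder traversal: true (1) on entering a vertex, false (0) on leaving it,
-- the root included, so that the code of T has length 2 * size T.
mutual
  encode : Tree → List Bool
  encode (node ts) = true ∷ encodes ts ++ false ∷ []

  encodes : List Tree → List Bool
  encodes []       = []
  encodes (t ∷ ts) = encode t ++ encodes ts

-- Deterministic multi-tape Turing machines with two-way infinite tapes.

data Symbol (g : ℕ) : Set where
  blank : Symbol g
  bit   : Bool → Symbol g
  extra : Fin g → Symbol g

data Move : Set where
  left right stay : Move

-- halted true is the accepting state, halted false the rejecting one.
data State (q : ℕ) : Set where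
  running : Fin q → State q
  halted  : Bool → State q

record TM : Set where
  field
    #states #extra #work : ℕ
    start : State #states

  #tapes : ℕ
  #tapes = suc #work

  field
    δ : Fin #states → Vec (Symbol #extra) #tapes →
        State #states × Vec (Symbol #extra × Move) #tapes

-- Cells to the left and to the right of the head are listed outwards from it;
-- all cells beyond the ends of the two lists are blank.
record Tape (g : ℕ) : Set where
  constructor tape
  field
    before  : List (Symbol g)
    current : Symbol g
    after   : List (Symbol g)

module _ {g : ℕ} where

  blankTape : Tape g
  blankTape = tape [] blank []

  inputTape : List Bool → Tape g
  inputTape []       = blankTape
  inputTape (b ∷ bs) = tape [] (bit b) (map bit bs)

  move : Move → Tape g → Tape g
  move stay  t                   = t
  move left  (tape []       c r) = tape [] blank (c ∷ r)
  move left  (tape (x ∷ l)  c r) = tape l x (c ∷ r)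
  move right (tape l c [])       = tape (c ∷ l) blank []
  move right (tape l c (x ∷ r))  = tape (c ∷ l) x r

  writeMove : Symbol g × Move → Tape g → Tape g
  writeMove (s , m) (tape l _ r) = move m (tape l s r)

module _ (M : TM) where
  open TM M

  Config : Set
  Config = State #states × Vec (Tape #extra) #tapes

  initial : List Bool → Config
  initial w = start , inputTape w Vec.∷ Vec.replicate #work blankTape

  step : Config → Config
  step (halted b  , ts) = halted b , ts
  step (running s , ts) =
    let s′ , actions = δ s (Vec.map Tape.current ts)
    in  s′ , Vec.zipWith writeMove actions ts

  runFor : ℕ → Config → Config
  runFor zero    c = c
  runFor (suc n) c = runFor n (step c)

  -- Halted configurations do not change any more, so being halted after t
  -- steps means having halted within t steps.
  DecidesWithin : ℕ → List Bool → Set → Set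
  DecidesWithin t w P =
    ∃[ b ] proj₁ (runFor t (initial w)) ≡ halted b × Reflects P b

-- Coefficients are listed from the constant term upwards.
evalPoly : List ℕ → ℕ → ℕ
evalPoly cs n = foldr (λ c r → c + n * r) 0 cs

PolyTimeDecidable : (Instance Property : Tree → Set) → Set
PolyTimeDecidable Instance Property =
  ∃[ M ] ∃[ p ] (∀ T → Instance T →
    DecidesWithin M (evalPoly p (size T)) (encode T) (Property T))

{-# OPTIONS --safe #-}

-- A tree with at least two vertices is add-prime exactly when its root has a
-- single child: two or more children can be distributed over two terms
-- different from 𝟏, and conversely the root of A ⊕ B has as many children as
-- the roots of A and B together.  A machine with one work tape recognises this
-- in linear time: it follows the depth of the traversal with the head of the
-- work tape, and when the first child of the root has been left, it accepts or
-- rejects according to whether the next symbol leaves the root or enters a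
-- second child.
module Submission where

open import Data.Bool using (Bool; true; false; not; if_then_else_)
open import Data.Fin using (Fin; zero; suc)
open import Data.List using (List; []; _∷_; _++_; map; replicate)
open import Data.List.Properties using (++-assoc; ++-identityʳ)
open import Data.Nat using (ℕ; zero; suc; pred; _+_; _*_; _≤_; _<_; z≤n; s≤s)
open import Data.Nat.Properties using (+-comm; m≤m+n; m≤n⇒∃[o]m+o≡n)
open import Data.Nat.Tactic.RingSolver using (solve-∀)
open import Data.Product using (_×_; _,_; ∃-syntax; proj₁)
open import Data.Sum using (inj₁; inj₂)
open import Data.Vec as Vec using (Vec)
open import Function.Bundles using (Equivalence; Inverse; mk⇔)
open import Function.Construct.Identity using (⇔-id)
open import Function.Properties.Inverse using (↔-refl; ↔-sym)
open import Relation.Binary.PropositionalEquality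
open import Relation.Nullary using (¬_)
open import Relation.Nullary.Reflects using (Reflects; ofʸ; ofⁿ)

open import Defs

-- Isomorphisms, and add-primality as having a single root child

≅-refl : ∀ {T} → T ≅ T
≅-refl = record
  { bijection      = ↔-refl
  ; root-preserved = refl
  ; edge-preserved = λ u v → ⇔-id (u ⟶ v)
  }

≅-sym : ∀ {T U} → T ≅ U → U ≅ T
≅-sym {T} {U} φ = record
  { bijection      = ↔-sym bijection
  ; root-preserved = trans (cong from (sym root-preserved)) (strictlyInverseʳ root)
  ; edge-preserved = λ u v → mk⇔
      (λ e → Equivalence.from (edge-preserved (from u) (from v))
        (subst₂ _⟶_ (sym (strictlyInverseˡ u)) (sym (strictlyInverseˡ v)) e))
      (λ e → subst₂ _⟶_ (strictlyInverseˡ u) (strictlyInverseˡ v)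
        (Equivalence.to (edge-preserved (from u) (from v)) e))
  }
  where
  open _≅_ φ
  open Inverse bijection using (strictlyInverseˡ; strictlyInverseʳ)

to-injective : ∀ {T U} (φ : T ≅ U) {u v} → _≅_.to φ u ≡ _≅_.to φ v → u ≡ v
to-injective φ {u} {v} eq =
  trans (sym (strictlyInverseʳ u)) (trans (cong from eq) (strictlyInverseʳ v))
  where
  open _≅_ φ
  open Inverse bijection using (strictlyInverseʳ)

to-child : ∀ {T U} (φ : T ≅ U) {v} → root ⟶ v → root ⟶ _≅_.to φ v
to-child φ {v} e =
  subst (_⟶ to v) root-preserved (Equivalence.to (edge-preserved root v) e)
  where open _≅_ φ

only-root : (v : Vertex 𝟏) → v ≡ root
only-root root = refl

only-child : ∀ {t} {u v : Vertex (node (t ∷ []))} → root ⟶ u → root ⟶ v → u ≡ v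
only-child (top zero) (top zero) = refl

nonempty≇𝟏 : ∀ {t ts} → ¬ node (t ∷ ts) ≅ 𝟏
nonempty≇𝟏 φ
  with () ← to-injective φ {below zero root} {root}
              (trans (only-root _) (sym (only-root _)))

-- Children of the root go to children of the root, so two of them would share the only available
-- image, against injectivity.
two-children≇one-child : ∀ {t a b cs} → ¬ node (a ∷ b ∷ cs) ≅ node (t ∷ [])
two-children≇one-child φ
  with () ← to-injective φ {below zero root} {below (suc zero) root}
              (only-child (to-child φ (top zero)) (to-child φ (top (suc zero))))

one-child⇒addPrime : ∀ t → AddPrime (node (t ∷ []))
one-child⇒addPrime (node us) = s≤s (s≤s z≤n) , split
  where
  T = node (node us ∷ [])

  split : ∀ A B → T ≅ A ⊕ B → _
  split (node []) (node bs) φ = inj₁ (≅-refl , ≅-sym φ)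
  split (node as@(_ ∷ _)) (node []) φ =
    inj₂ (≅-sym (subst (λ cs → T ≅ node cs) (++-identityʳ as) φ) , ≅-refl)
  -- The first list is split once more so that `_++_` computes far enough to exhibit two children of
  -- the root of the sum.
  split (node (_ ∷ [])) (node (_ ∷ _)) φ with () ← two-children≇one-child (≅-sym φ)
  split (node (_ ∷ _ ∷ _)) (node (_ ∷ _)) φ with () ← two-children≇one-child (≅-sym φ)

two-children⇒¬addPrime : ∀ t u ts → ¬ AddPrime (node (t ∷ u ∷ ts))
two-children⇒¬addPrime t u ts (_ , split)
  -- Splitting off the first child gives back the same tree by computation, and neither term is `𝟏`.
  with split (node (t ∷ [])) (node (u ∷ ts)) ≅-refl
... | inj₁ (A≅𝟏 , _) = nonempty≇𝟏 A≅𝟏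
... | inj₂ (_ , B≅𝟏) = nonempty≇𝟏 B≅𝟏

-- Composing and prolonging runs

module _ (M : TM) where

  runFor-+ : ∀ m n c → runFor M (m + n) c ≡ runFor M n (runFor M m c)
  runFor-+ zero    n c = refl
  runFor-+ (suc m) n c = runFor-+ m n (step M c)

  runFor-halted : ∀ n {b} c → proj₁ c ≡ halted b → proj₁ (runFor M n c) ≡ halted b
  runFor-halted zero    c               eq   = eq
  runFor-halted (suc n) (halted b , ts) refl = runFor-halted n (halted b , ts) refl

  runFor-≤ : ∀ {m n b} c → m ≤ n →
    proj₁ (runFor M m c) ≡ halted b → proj₁ (runFor M n c) ≡ halted b
  runFor-≤ {m} c m≤n eq with k , refl ← m≤n⇒∃[o]m+o≡n m≤n =
    trans (cong proj₁ (runFor-+ m k c)) (runFor-halted k (runFor M m c) eq)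

-- The machine and its configurations while scanning

pattern enterRoot  = zero
pattern enterChild = suc zero
pattern scan       = suc (suc zero)

-- On the work tape, cell 0 carries the only non-blank symbol.  In state scan
-- the head is at cell d when the current vertex has depth d.
rootChildren : TM
rootChildren = record
  { #states = 3 ; #extra = 0 ; #work = 1 ; start = running enterRoot ; δ = δ }
  where
  δ : Fin 3 → Vec (Symbol 0) 2 → State 3 × Vec (Symbol 0 × Move) 2
  δ enterRoot (s Vec.∷ c Vec.∷ Vec.[]) =
    running enterChild , (s , right) Vec.∷ (c , stay) Vec.∷ Vec.[]
  δ enterChild (s Vec.∷ c Vec.∷ Vec.[]) =
    running scan , (s , right) Vec.∷ (bit true , right) Vec.∷ Vec.[]
  δ scan (bit b Vec.∷ blank Vec.∷ Vec.[]) =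
    running scan ,
    (bit b , right) Vec.∷ (blank , (if b then right else left)) Vec.∷ Vec.[]
  δ scan (bit b Vec.∷ c Vec.∷ Vec.[]) =
    halted (not b) , (bit b , stay) Vec.∷ (c , stay) Vec.∷ Vec.[]
  δ scan (s Vec.∷ c Vec.∷ Vec.[]) =
    halted false , (s , stay) Vec.∷ (c , stay) Vec.∷ Vec.[]

unread : List (Symbol 0) → List Bool → Tape 0
unread l []      = tape l blank []
unread l (b ∷ w) = tape l (bit b) (map bit w)

unread-right : ∀ l b w →
  writeMove (bit b , right) (unread l (b ∷ w)) ≡ unread (bit b ∷ l) w
unread-right l b []      = refl
unread-right l b (_ ∷ _) = refl

-- The number j of blanks listed after the head only records how far the head
-- has been.
counter : ℕ → ℕ → Tape 0
counter zero    j = tape [] (bit true) (replicate j blank)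
counter (suc d) j =
  tape (replicate d blank ++ bit true ∷ []) blank (replicate j blank)

-- Moving right uses up one recorded blank; if none is recorded, the tape supplies a fresh one and
-- the record stays empty, hence `pred`.
counter-right : ∀ d j →
  writeMove (blank , right) (counter (suc d) j) ≡ counter (suc (suc d)) (pred j)
counter-right d zero    = refl
counter-right d (suc j) = refl

counter-left : ∀ d j →
  writeMove (blank , left) (counter (suc d) j) ≡ counter d (suc j)
counter-left zero    j = refl
counter-left (suc d) j = refl

scanning : List (Symbol 0) → List Bool → ℕ → ℕ → Config rootChildren
scanning l w d j =
  running scan , unread l w Vec.∷ counter d j Vec.∷ Vec.[]

step-enter : ∀ l w d j →
  step rootChildren (scanning l (true ∷ w) (suc d) j)
    ≡ scanning (bit true ∷ l) w (suc (suc d)) (pred j)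
step-enter l w d j =
  cong₂ (λ t u → running scan , t Vec.∷ u Vec.∷ Vec.[])
    (unread-right l true w) (counter-right d j)

step-leave : ∀ l w d j →
  step rootChildren (scanning l (false ∷ w) (suc d) j)
    ≡ scanning (bit false ∷ l) w d (suc j)
step-leave l w d j =
  cong₂ (λ t u → running scan , t Vec.∷ u Vec.∷ Vec.[])
    (unread-right l false w) (counter-left d j)

encodes-node : ∀ us ts w →
  encodes (node us ∷ ts) ++ w ≡ true ∷ encodes us ++ false ∷ encodes ts ++ w
encodes-node us ts w = cong (true ∷_) (begin
  ((encodes us ++ false ∷ []) ++ encodes ts) ++ w
    ≡⟨ ++-assoc (encodes us ++ false ∷ []) (encodes ts) w ⟩
  (encodes us ++ false ∷ []) ++ encodes ts ++ w
    ≡⟨ ++-assoc (encodes us) (false ∷ []) (encodes ts ++ w) ⟩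
  encodes us ++ false ∷ encodes ts ++ w ∎)
  where open ≡-Reasoning

-- The step budget for a nonempty forest: one step enters the first tree, `m * 2` scan its subtrees,
-- one leaves it, and `n * 2` scan the other trees.
sizes-node : ∀ m n → (suc m + n) * 2 ≡ suc (m * 2 + suc (n * 2))
sizes-node = solve-∀

-- Starting at depth `suc d`, the scan of a forest only visits cells at or beyond the starting one,
-- so the head never meets the marker in cell 0 and the machine cannot halt early. The arbitrary
-- continuation `w` makes the induction go through; `l′` and `j′` merely record the past of the two
-- heads.
scan-encodes : ∀ ts l w d j → ∃[ l′ ] ∃[ j′ ]
  runFor rootChildren (sizes ts * 2) (scanning l (encodes ts ++ w) (suc d) j)
    ≡ scanning l′ w (suc d) j′
scan-encodes [] l w d j = l , j , refl
scan-encodes (node us ∷ ts) l w d j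
  with l₁ , j₁ , eq₁ ←
         scan-encodes us (bit true ∷ l) (false ∷ encodes ts ++ w) (suc d) (pred j)
  with l₂ , j₂ , eq₂ ← scan-encodes ts (bit false ∷ l₁) w d (suc j₁)
  = l₂ , j₂ , (begin
    run ((suc m + n) * 2) (scanning l (encodes (node us ∷ ts) ++ w) (suc d) j)
      ≡⟨ cong₂ (λ k v → run k (scanning l v (suc d) j))
           (sizes-node m n) (encodes-node us ts w) ⟩
    run (m * 2 + suc (n * 2)) (step rootChildren (scanning l (true ∷ v₁) (suc d) j))
      ≡⟨ cong (run (m * 2 + suc (n * 2))) (step-enter l v₁ d j) ⟩
    run (m * 2 + suc (n * 2)) (scanning (bit true ∷ l) v₁ (suc (suc d)) (pred j))
      ≡⟨ runFor-+ rootChildren (m * 2) (suc (n * 2)) _ ⟩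
    run (suc (n * 2)) (run (m * 2) (scanning (bit true ∷ l) v₁ (suc (suc d)) (pred j)))
      ≡⟨ cong (run (suc (n * 2))) eq₁ ⟩
    run (n * 2) (step rootChildren (scanning l₁ (false ∷ v₂) (suc (suc d)) j₁))
      ≡⟨ cong (run (n * 2)) (step-leave l₁ v₂ (suc d) j₁) ⟩
    run (n * 2) (scanning (bit false ∷ l₁) v₂ (suc d) (suc j₁))
      ≡⟨ eq₂ ⟩
    scanning l₂ w (suc d) j₂ ∎)
  where
  open ≡-Reasoning
  run = runFor rootChildren
  m = sizes us
  n = sizes ts
  v₂ = encodes ts ++ w
  v₁ = encodes us ++ false ∷ v₂

run-rootChildren : ∀ us b w →
  proj₁ (runFor rootChildren (4 + sizes us * 2)
    (initial rootChildren (true ∷ true ∷ encodes us ++ false ∷ b ∷ w)))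
    ≡ halted (not b)
run-rootChildren us b w
  with l , j , eq ← scan-encodes us (bit true ∷ bit true ∷ []) (false ∷ b ∷ w) 0 0
  = cong proj₁ (begin
    run (4 + m) (initial rootChildren (true ∷ true ∷ v))
      -- The first two steps compute, except that the move onto the head of `v` is stuck until `v`
      -- is split.
      ≡⟨ cong (λ t → run (2 + m) (running scan , t Vec.∷ counter 1 0 Vec.∷ Vec.[]))
           (unread-right (bit true ∷ []) true v) ⟩
    run (2 + m) (scanning (bit true ∷ bit true ∷ []) v 1 0)
      ≡⟨ cong (λ k → run k (scanning (bit true ∷ bit true ∷ []) v 1 0)) (+-comm 2 m) ⟩
    run (m + 2) (scanning (bit true ∷ bit true ∷ []) v 1 0)
      ≡⟨ runFor-+ rootChildren m 2 _ ⟩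
    run 2 (run m (scanning (bit true ∷ bit true ∷ []) v 1 0))
      ≡⟨ cong (run 2) eq ⟩
    -- One step leaves the first child and brings the head onto the marker; the other reads `b`
    -- there and halts.
    run 2 (scanning l (false ∷ b ∷ w) 1 j) ∎)
  where
  open ≡-Reasoning
  run = runFor rootChildren
  m = sizes us * 2
  v = encodes us ++ false ∷ b ∷ w

encode-node : ∀ us ts → encode (node (node us ∷ ts))
  ≡ true ∷ true ∷ encodes us ++ false ∷ encodes ts ++ false ∷ []
encode-node us ts = cong (true ∷_) (encodes-node us ts (false ∷ []))

-- The polynomial is twice the number of vertices. The run stops right after the first child, so the
-- `n` vertices of its siblings contribute only the slack `n * 2`.
time-bound : ∀ m n → 4 + m * 2 ≤ evalPoly (0 ∷ 2 ∷ []) (2 + (m + n))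
time-bound m n = subst (4 + m * 2 ≤_) (eq m n) (m≤m+n (4 + m * 2) (n * 2))
  where
  eq : ∀ m n → 4 + m * 2 + n * 2 ≡ (2 + (m + n)) * (2 + (2 + (m + n)) * 0)
  eq = solve-∀

-- The equation isolates the symbol following the code of the first child: `false` if `ts` is empty
-- and `true` otherwise, which covers both answers with one run.
decides : ∀ us ts {b w} → encodes ts ++ false ∷ [] ≡ b ∷ w →
  Reflects (AddPrime (node (node us ∷ ts))) (not b) →
  DecidesWithin rootChildren (evalPoly (0 ∷ 2 ∷ []) (size (node (node us ∷ ts))))
    (encode (node (node us ∷ ts))) (AddPrime (node (node us ∷ ts)))
decides us ts {b} {w} eq r =
  not b ,
  runFor-≤ rootChildren (initial rootChildren (encode T))
    (time-bound (sizes us) (sizes ts))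
    (subst
      (λ v → proj₁ (runFor rootChildren (4 + sizes us * 2) (initial rootChildren v))
               ≡ halted (not b))
      (sym code) (run-rootChildren us b w)) ,
  r
  where
  T = node (node us ∷ ts)

  code : encode T ≡ true ∷ true ∷ encodes us ++ false ∷ b ∷ w
  code = trans (encode-node us ts)
    (cong (λ v → true ∷ true ∷ encodes us ++ false ∷ v) eq)

mainTheorem12 : PolyTimeDecidable (λ T → 1 < size T) AddPrime
mainTheorem12 = rootChildren , 0 ∷ 2 ∷ [] , λ where
  (node []) (s≤s ())
  (node (node us ∷ [])) _ →
    decides us [] refl (ofʸ (one-child⇒addPrime (node us)))
  (node (node us ∷ node vs ∷ ts)) _ →
    decides us (node vs ∷ ts) refl (ofⁿ (two-children⇒¬addPrime (node us) (node vs) ts))
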